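{- Let $B$ be a finite Boolean algebra equipped with a preconditional $\to$ satisfying modus ponens, identity, normality, and negation import. Let $W$ be the set of atoms of $B$ and let $\widehat{(\cdot)}$ be the isomorphism from $B$ to $\wp(W)$, $\widehat{a}=\{w\in W\mid w\leq a\}$. For $a\in B$ and $w,v\in W$, define $$wR_{\widehat{a}}v\ \text{ iff for all } b\in B,\ w\leq a\to b \text{ implies } v\leq b.$$ Then $(W,\{R_A\}_{A\subseteq W})$ is a strongly dense, functional selection frame, and $(B,\to)$ is isomorphic to $(\wp(W),\to_R)$, where $A\to_R C:=\{w\in W\mid \text{for all } v\in W,\ wR_Av\Rightarrow v\in C\}$.
   Context: A preconditional on a bounded lattice $L$ is a binary operation $\to$ on $L$ such that for all $a,b,c\in L$: (1) $1\to a\leq a$; (2) $a\wedge b\leq a\to b$; (3) $a\to b\leq a\to(a\wedge b)$; (4) $a\to(b\wedge c)\leq a\to b$; (5) $a\to((a\wedge b)\to c)\leq (a\wedge b)\to c$. Further axioms (for all $a,b,c$): modus ponens: $a\wedge(a\to b)\leq b$; identity: $a\to a=1$; normality: $(a\to b)\wedge(a\to c)\leq a\to(b\wedge c)$; negation import: $\neg(a\to b)\leq a\to\neg b$, where $\neg$ is Boolean complement. A selection frame is a pair $(W,\{R_A\}_{A\subseteq W})$ where $W$ is a nonempty set and each $R_A$ is a binary relation on $W$ such that for all $w,v\in W$ and $A\subseteq W$: (success) if $wR_Av$, then $v\in A$; (centering) if $w\in A$, then $wR_Av$ iff $v=w$. It is functional if $wR_Av$ and $wR_Au$ imply $v=u$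 (for all $w,v,u\in W$, $A\subseteq W$). It is strongly dense if for all $w,v\in W$ and $A,B\subseteq W$: if $wR_{A\cap B}v$, then there is $u\in W$ with $wR_Au$ and $uR_{A\cap B}v$. -}

module Defs where

open import Algebra.Core using (Op₂)
open import Algebra.Definitions using (Congruent₂)
open import Algebra.Morphism.Definitions using (Homomorphic₀; Homomorphic₁; Homomorphic₂)
open import Data.Bool.Base using (Bool; true; false; T; not) renaming (_∧_ to _and_; _∨_ to _or_)
open import Data.Bool.Properties using (T-∧; T-∨)
open import Data.Fin.Base using (Fin)
import Data.Fin.Properties as Fin
open import Data.Product.Base using (Σ; ∃; ∃-syntax; _×_; _,_; proj₁; proj₂)
open import Data.Sum.Base as Sum using (_⊎_; inj₁; inj₂; [_,_]′)
open import Data.Unit.Base using (tt)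
open import Function.Base using (_∘_; id)
open import Function.Bundles using (Inverse; Func; Equivalence; _⇔_; mk⇔)
open import Level using (Level; _⊔_)
open import Relation.Binary.Bundles using (Setoid)
open import Relation.Binary.Core using (Rel)
open import Relation.Binary.Definitions using (_Respects_; Decidable)
open import Relation.Binary.Lattice.Bundles using (BoundedLattice; BooleanAlgebra)
open import Relation.Binary.Morphism.Structures using (IsOrderIsomorphism)
import Relation.Binary.Construct.On as On
open import Relation.Binary.PropositionalEquality as ≡ using (_≡_)
open import Relation.Nullary.Decidable as Dec
  using (Dec; yes; no; does; map′; _×-dec_; _⊎-dec_; _→-dec_; ¬?; T?)
open import Relation.Nullary.Negation using (¬_; contradiction)
open import Relation.Unary using (Pred) renaming (Decidable to Decidable₁)

private
  variable
    c c′ ℓ ℓ₁ ℓ₂ ℓ₁′ ℓ₂′ p r : Level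

------------------------------------------------------------------------
-- Conditional axioms

-- ⇒-cong is needed only because the equality of L is a setoid equality.
record IsPreconditional (L : BoundedLattice c ℓ₁ ℓ₂) (_⇒_ : Op₂ (BoundedLattice.Carrier L))
       : Set (c ⊔ ℓ₁ ⊔ ℓ₂) where
  open BoundedLattice L
  field
    ⇒-cong : Congruent₂ _≈_ _⇒_
    axiom₁ : ∀ a → (⊤ ⇒ a) ≤ a
    axiom₂ : ∀ a b → (a ∧ b) ≤ (a ⇒ b)
    axiom₃ : ∀ a b → (a ⇒ b) ≤ (a ⇒ (a ∧ b))
    axiom₄ : ∀ a b c → (a ⇒ (b ∧ c)) ≤ (a ⇒ b)
    axiom₅ : ∀ a b c → (a ⇒ ((a ∧ b) ⇒ c)) ≤ ((a ∧ b) ⇒ c)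

module _ (L : BoundedLattice c ℓ₁ ℓ₂) (_⇒_ : Op₂ (BoundedLattice.Carrier L)) where
  open BoundedLattice L

  ModusPonens : Set (c ⊔ ℓ₂)
  ModusPonens = ∀ a b → (a ∧ (a ⇒ b)) ≤ b

  Identity : Set (c ⊔ ℓ₁)
  Identity = ∀ a → (a ⇒ a) ≈ ⊤

  Normality : Set (c ⊔ ℓ₂)
  Normality = ∀ a b c → ((a ⇒ b) ∧ (a ⇒ c)) ≤ (a ⇒ (b ∧ c))

NegationImport : (B : BooleanAlgebra c ℓ₁ ℓ₂) → Op₂ (BooleanAlgebra.Carrier B) → Set (c ⊔ ℓ₂)
NegationImport B _⇒_ = ∀ a b → (∼ (a ⇒ b)) ≤ (a ⇒ (∼ b))
  where open BooleanAlgebra B renaming (¬_ to ∼_)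

------------------------------------------------------------------------
-- Isomorphisms

record IsBooleanIsomorphism (B : BooleanAlgebra c ℓ₁ ℓ₂) (C : BooleanAlgebra c′ ℓ₁′ ℓ₂′)
       (h : BooleanAlgebra.Carrier B → BooleanAlgebra.Carrier C)
       : Set (c ⊔ c′ ⊔ ℓ₁ ⊔ ℓ₂ ⊔ ℓ₁′ ⊔ ℓ₂′) where
  private
    module B = BooleanAlgebra B
    module C = BooleanAlgebra C
  field
    isOrderIsomorphism : IsOrderIsomorphism B._≈_ C._≈_ B._≤_ C._≤_ h
    ∧-homo : Homomorphic₂ B.Carrier C.Carrier C._≈_ h B._∧_ C._∧_
    ∨-homo : Homomorphic₂ B.Carrier C.Carrier C._≈_ h B._∨_ C._∨_
    ¬-homo : Homomorphic₁ B.Carrier C.Carrier C._≈_ h B.¬_ C.¬_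
    ⊤-homo : Homomorphic₀ B.Carrier C.Carrier C._≈_ h B.⊤ C.⊤
    ⊥-homo : Homomorphic₀ B.Carrier C.Carrier C._≈_ h B.⊥ C.⊥

Isomorphic : (B : BooleanAlgebra c ℓ₁ ℓ₂) → Op₂ (BooleanAlgebra.Carrier B) →
             (C : BooleanAlgebra c′ ℓ₁′ ℓ₂′) → Op₂ (BooleanAlgebra.Carrier C) →
             Set (c ⊔ c′ ⊔ ℓ₁ ⊔ ℓ₂ ⊔ ℓ₁′ ⊔ ℓ₂′)
Isomorphic B _⇒B_ C _⇒C_ =
  ∃[ h ] IsBooleanIsomorphism B C h × Homomorphic₂ B.Carrier C.Carrier C._≈_ h _⇒B_ _⇒C_
  where
  module B = BooleanAlgebra B
  module C = BooleanAlgebra C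

------------------------------------------------------------------------
-- Finite setoids

Finite : Setoid c ℓ → Set (c ⊔ ℓ)
Finite S = ∃[ n ] Inverse (≡.setoid (Fin n)) S

module FiniteSearch {S : Setoid c ℓ} (fin : Finite S) where
  open Setoid S
  open Inverse (proj₂ fin)

  infix 4 _≟_

  _≟_ : Decidable _≈_
  x ≟ y = map′ (λ e → trans (sym (strictlyInverseˡ x)) (trans (to-cong e) (strictlyInverseˡ y)))
               from-cong (from x Fin.≟ from y)

  all? : {P : Pred Carrier p} → P Respects _≈_ → Decidable₁ P → Dec (∀ x → P x)
  all? resp P? = map′ (λ f x → resp (strictlyInverseˡ x) (f (from x))) (λ f i → f (to i))
                      (Fin.all? (P? ∘ to))

  any? : {P : Pred Carrier p} → P Respects _≈_ → Decidable₁ P → Dec (∃ P)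
  any? resp P? = map′ (λ (i , q) → to i , q)
                      (λ (x , q) → from x , resp (sym (strictlyInverseˡ x)) q)
                      (Fin.any? (P? ∘ to))

------------------------------------------------------------------------
-- Powersets

-- Subsets are decidable; over the finite sets considered below these are,
-- classically, all the subsets.
module Powerset (W : Setoid c ℓ) where
  open Setoid W

  Subset : Set (c ⊔ ℓ)
  Subset = Func W (≡.setoid Bool)

  infix 4 _∈_ _⊆_ _≐_
  infixr 7 _∩_
  infixr 6 _∪_

  _∈_ : Carrier → Subset → Set
  w ∈ A = T (Func.to A w)

  ∈-resp : ∀ A → (_∈ A) Respects _≈_
  ∈-resp A e = ≡.subst T (Func.cong A e)

  _∈?_ : ∀ w A → Dec (w ∈ A)
  w ∈? A = T? (Func.to A w)

  _⊆_ : Rel Subset c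
  A ⊆ C = ∀ w → w ∈ A → w ∈ C

  _≐_ : Rel Subset c
  A ≐ C = A ⊆ C × C ⊆ A

  _∩_ _∪_ : Op₂ Subset
  A ∩ C = record
    { to = λ w → Func.to A w and Func.to C w
    ; cong = λ e → ≡.cong₂ _and_ (Func.cong A e) (Func.cong C e) }
  A ∪ C = record
    { to = λ w → Func.to A w or Func.to C w
    ; cong = λ e → ≡.cong₂ _or_ (Func.cong A e) (Func.cong C e) }

  ∁ : Subset → Subset
  ∁ A = record { to = not ∘ Func.to A ; cong = ≡.cong not ∘ Func.cong A }

  full ∅ : Subset
  full = record { to = λ _ → true ; cong = λ _ → ≡.refl }
  ∅ = record { to = λ _ → false ; cong = λ _ → ≡.refl }

  -- The subset { w | P w }.
  ⟪_⟫ : {P : Pred Carrier p} → Decidable₁ P → P Respects _≈_ → Subset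
  ⟪ P? ⟫ resp = record
    { to = λ w → does (P? w)
    ; cong = λ {x} {y} e → agree (P? x) (P? y) (resp e) (resp (sym e)) }
    where
    agree : ∀ {a b} {X : Set a} {Y : Set b} (X? : Dec X) (Y? : Dec Y) →
            (X → Y) → (Y → X) → does X? ≡ does Y?
    agree X? Y? f g = Dec.does-⇔ (mk⇔ f g) X? Y?

  ∈⟪⟫ : {P : Pred Carrier p} (P? : Decidable₁ P) (resp : P Respects _≈_) →
        ∀ w → (w ∈ ⟪ P? ⟫ resp) ⇔ P w
  ∈⟪⟫ P? resp w = T-does (P? w)
    where
    T-does : ∀ {a} {X : Set a} (X? : Dec X) → T (does X?) ⇔ X
    T-does (yes x) = mk⇔ (λ _ → x) _
    T-does (no ¬x) = mk⇔ (λ ()) ¬x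

  ℘ : BooleanAlgebra (c ⊔ ℓ) c c
  ℘ = record
    { Carrier = Subset ; _≈_ = _≐_ ; _≤_ = _⊆_
    ; _∨_ = _∪_ ; _∧_ = _∩_ ; ¬_ = ∁ ; ⊤ = full ; ⊥ = ∅
    ; isBooleanAlgebra = record { isHeytingAlgebra = record
      { isBoundedLattice = record
        { isLattice = record
          { isPartialOrder = record
            { isPreorder = record
              { isEquivalence = record
                { refl = (λ _ → id) , (λ _ → id)
                ; sym = λ (f , g) → g , f
                ; trans = λ (f , g) (h , k) → (λ w → h w ∘ f w) , (λ w → g w ∘ k w) }
              ; reflexive = proj₁
              ; trans = λ f g w → g w ∘ f w }
            ; antisym = _,_ }
          ; supremum = λ A C →
              (λ _ → Equivalence.from T-∨ ∘ inj₁) ,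
              (λ _ → Equivalence.from T-∨ ∘ inj₂) ,
              (λ _ f g w → [ f w , g w ]′ ∘ Equivalence.to T-∨)
          ; infimum = λ A C →
              (λ _ → proj₁ ∘ Equivalence.to T-∧) ,
              (λ _ → proj₂ ∘ Equivalence.to T-∧) ,
              (λ _ f g w x → Equivalence.from T-∧ (f w x , g w x)) }
        ; maximum = λ _ _ _ → tt
        ; minimum = λ _ _ () }
      ; exponential = λ A C D →
          (λ f w → curry (Func.to A w) (Func.to C w) (Func.to D w) (f w)) ,
          (λ f w → uncurry (Func.to A w) (Func.to C w) (Func.to D w) (f w)) } } }
    where
    curry : ∀ a b d → (T (a and b) → T d) → T a → T (not b or d)
    curry true true  d f x = f tt
    curry true false d f x = tt

    uncurry : ∀ a b d → (T a → T (not b or d)) → T (a and b) → T d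
    uncurry true true d f x = f tt

------------------------------------------------------------------------
-- Selection frames

module _ (W : Setoid c ℓ) where
  open Setoid W
  open Powerset W

  -- R-resp says that R is well defined up to the equalities of W and of ℘.
  record IsSelectionFrame (R : Subset → Rel Carrier r) : Set (c ⊔ ℓ ⊔ r) where
    field
      nonempty  : Carrier
      R-resp    : ∀ {A C w x v u} → A ≐ C → w ≈ x → v ≈ u → R A w v → R C x u
      success   : ∀ w v A → R A w v → v ∈ A
      centering : ∀ w v A → w ∈ A → R A w v ⇔ v ≈ w

  Functional : (Subset → Rel Carrier r) → Set (c ⊔ ℓ ⊔ r)
  Functional R = ∀ w v u A → R A w v → R A w u → v ≈ u

  StronglyDense : (Subset → Rel Carrier r) → Set (c ⊔ ℓ ⊔ r)
  StronglyDense R = ∀ w v A C → R (A ∩ C) w v → ∃[ u ] R A w u × R (A ∩ C) u v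

  Conditional : (Subset → Rel Carrier r) → Subset → Subset → Pred Carrier (c ⊔ r)
  Conditional R A C w = ∀ v → R A w v → v ∈ C

  -- A →_R C, given that its membership predicate is decidable and respects ≈.
  frameConditional : (R : Subset → Rel Carrier r) →
                     (∀ A C → Decidable₁ (Conditional R A C)) →
                     (∀ A C → Conditional R A C Respects _≈_) →
                     Op₂ Subset
  frameConditional R dec resp A C = ⟪ dec A C ⟫ (resp A C)

------------------------------------------------------------------------
-- The frame of atoms

module AtomFrame (B : BooleanAlgebra c ℓ₁ ℓ₂) (fin : Finite (BooleanAlgebra.setoid B))
                 (_⇒_ : Op₂ (BooleanAlgebra.Carrier B))
                 (isPreconditional : IsPreconditional (BooleanAlgebra.boundedLattice B) _⇒_)
                 where
  open BooleanAlgebra B hiding (¬_)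
  open IsPreconditional isPreconditional using (⇒-cong)
  open FiniteSearch fin

  infix 4 _≤?_

  _≤?_ : Decidable _≤_
  x ≤? y = map′ (λ e → trans (reflexive (Eq.sym e)) (x∧y≤y x y))
                (λ x≤y → antisym (x∧y≤x x y) (∧-greatest refl x≤y))
                (x ∧ y ≟ x)

  ≤-resp : ∀ {x x′ y y′} → x ≈ x′ → y ≈ y′ → x ≤ y → x′ ≤ y′
  ≤-resp e f le = trans (reflexive (Eq.sym e)) (trans le (reflexive f))

  IsAtom : Pred Carrier (c ⊔ ℓ₁ ⊔ ℓ₂)
  IsAtom x = ¬ (x ≈ ⊥) × (∀ y → y ≤ x → y ≈ ⊥ ⊎ y ≈ x)

  isAtom? : Decidable₁ IsAtom
  isAtom? x = ¬? (x ≟ ⊥) ×-dec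
    all? (λ e f le → Sum.map (Eq.trans (Eq.sym e)) (Eq.trans (Eq.sym e))
                             (f (≤-resp (Eq.sym e) Eq.refl le)))
         (λ y → y ≤? x →-dec (y ≟ ⊥ ⊎-dec y ≟ x))

  isAtom-resp : IsAtom Respects _≈_
  isAtom-resp e (x≉⊥ , min) =
    x≉⊥ ∘ Eq.trans e ,
    λ y y≤x′ → Sum.map₂ (λ y≈x → Eq.trans y≈x e) (min y (≤-resp Eq.refl (Eq.sym e) y≤x′))

  W : Setoid (c ⊔ ℓ₁ ⊔ ℓ₂) ℓ₁
  W = On.setoid {B = Σ Carrier IsAtom} setoid proj₁

  Atom : Set (c ⊔ ℓ₁ ⊔ ℓ₂)
  Atom = Setoid.Carrier W

  open Powerset W public

  -- â = { w | w ≤ a }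
  hat : Carrier → Subset
  hat a = ⟪ (λ w → proj₁ w ≤? a) ⟫ (λ e → ≤-resp e Eq.refl)

  ∈hat : ∀ a w → (w ∈ hat a) ⇔ (proj₁ w ≤ a)
  ∈hat a = ∈⟪⟫ (λ w → proj₁ w ≤? a) (λ e → ≤-resp e Eq.refl)

  Rhat : Carrier → Rel Atom (c ⊔ ℓ₂)
  Rhat a (w , _) (v , _) = ∀ b → w ≤ (a ⇒ b) → v ≤ b

  -- Every subset of W is â for exactly one a, up to ≈, so this says that
  -- R (hat a) is Rhat a.
  R : Subset → Rel Atom (c ⊔ ℓ₁ ⊔ ℓ₂)
  R A w v = ∃[ a ] hat a ≐ A × Rhat a w v

  atom-all? : {P : Pred Atom p} → P Respects (Setoid._≈_ W) → Decidable₁ P → Dec (∀ w → P w)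
  atom-all? {P = P} resp P? = map′ (λ f (x , m) → f x m) (λ f x m → f (x , m))
    (all? (λ e f m′ → resp e (f (isAtom-resp (Eq.sym e) m′))) at)
    where
    at : Decidable₁ (λ x → (m : IsAtom x) → P (x , m))
    at x with isAtom? x
    ... | no ¬m = yes (λ m → contradiction m ¬m)
    ... | yes m = map′ (λ q _ → resp Eq.refl q) (λ f → f m) (P? (x , m))

  hat-mono : ∀ {a a′} → a ≤ a′ → hat a ⊆ hat a′
  hat-mono {a} {a′} le w w∈ =
    Equivalence.from (∈hat a′ w) (trans (Equivalence.to (∈hat a w) w∈) le)

  hat-cong : ∀ {a a′} → a ≈ a′ → hat a ≐ hat a′
  hat-cong e = hat-mono (reflexive e) , hat-mono (reflexive (Eq.sym e))

  ⊆? : Decidable _⊆_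
  ⊆? A C = atom-all? (λ e f → ∈-resp C e ∘ f ∘ ∈-resp A (Eq.sym e))
                     (λ w → (w ∈? A) →-dec (w ∈? C))

  Rhat? : ∀ a → Decidable (Rhat a)
  Rhat? a (w , _) (v , _) =
    all? (λ e f le → ≤-resp Eq.refl e (f (≤-resp Eq.refl (⇒-cong Eq.refl (Eq.sym e)) le)))
         (λ b → w ≤? (a ⇒ b) →-dec v ≤? b)

  Rhat-resp : ∀ {a a′ w w′ v v′} → a ≈ a′ → proj₁ w ≈ proj₁ w′ → proj₁ v ≈ proj₁ v′ →
              Rhat a w v → Rhat a′ w′ v′
  Rhat-resp ea ew ev f b le =
    ≤-resp ev Eq.refl (f b (≤-resp (Eq.sym ew) (⇒-cong (Eq.sym ea) Eq.refl) le))

  R? : ∀ A → Decidable (R A)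
  R? A w v =
    any? (λ e ((f , g) , q) → ( (λ u → f u ∘ proj₁ (hat-cong (Eq.sym e)) u)
                              , (λ u → proj₂ (hat-cong (Eq.sym e)) u ∘ g u))
                            , Rhat-resp {w = w} {w} {v} {v} e Eq.refl Eq.refl q)
         (λ a → (⊆? (hat a) A ×-dec ⊆? A (hat a)) ×-dec Rhat? a w v)

  R-resp-≈ : ∀ A {w w′ v v′} → proj₁ w ≈ proj₁ w′ → proj₁ v ≈ proj₁ v′ → R A w v → R A w′ v′
  R-resp-≈ A {w} {w′} {v} {v′} ew ev (a , h , q) =
    a , h , Rhat-resp {w = w} {w′} {v} {v′} Eq.refl ew ev q

  R-conditional? : ∀ A C → Decidable₁ (Conditional W R A C)
  R-conditional? A C w =
    atom-all? (λ {v} {v′} e f → ∈-resp C {v} {v′} e ∘ f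
                              ∘ R-resp-≈ A {w} {w} {v′} {v} Eq.refl (Eq.sym e))
              (λ v → R? A w v →-dec (v ∈? C))

  R-conditional-resp : ∀ A C → Conditional W R A C Respects (Setoid._≈_ W)
  R-conditional-resp A C {w} {w′} e f v =
    f v ∘ R-resp-≈ A {w′} {w} {v} {v} (Eq.sym e) Eq.refl

  _→R_ : Op₂ Subset
  _→R_ = frameConditional W R R-conditional? R-conditional-resp

{-# OPTIONS --safe #-}

-- Fix a ∈ B and an atom w. Normality and axiom 4 make F = { b | w ≤ a ⇒ b } a
-- filter, identity puts a in it, and negation import makes it contain b or ∼ b
-- for every b. So if F is proper it is generated by an atom, which is then the
-- unique v with w R_â v; if F is improper there is no such v. In both cases b ∈ F
-- iff b lies above every R_â-successor of w, which is preservation of ⇒.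
-- Centering is modus ponens together with axiom 2, and strong density is axiom 5
-- applied to the generator of F.
module Submission where

open import Defs
open import Algebra.Core using (Op₂)
open import Data.Bool.Base using (true; false; T; not)
open import Data.Bool.Properties using (T-∧; T-∨)
open import Data.Fin.Base using (Fin; zero; suc)
open import Data.Nat.Base using (zero; suc)
open import Data.Product.Base using (∃-syntax; _×_; _,_; proj₁; proj₂)
open import Data.Sum.Base using (_⊎_; inj₁; inj₂; [_,_]′)
open import Data.Unit.Base using (tt)
open import Function.Base using (_∘_; id)
open import Function.Bundles using (Inverse; Equivalence; _⇔_; mk⇔)
open import Level using (Level; _⊔_)
open import Relation.Binary.Lattice.Bundles using (BooleanAlgebra)
open import Relation.Binary.Morphism.Structures using (IsOrderIsomorphism)
open import Relation.Nullary.Decidable using (yes; no)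
open import Relation.Nullary.Negation using (¬_; contradiction)
open import Relation.Unary using (Pred)

private
  variable
    c ℓ₁ ℓ₂ p : Level

T-not⁺ : ∀ {b} → ¬ T b → T (not b)
T-not⁺ {true}  ¬b = ¬b tt
T-not⁺ {false} _  = tt

T-not⁻ : ∀ {b} → T (not b) → ¬ T b
T-not⁻ {false} _ ()

module FiniteBooleanAlgebra
  (B : BooleanAlgebra c ℓ₁ ℓ₂) (fin : Finite (BooleanAlgebra.setoid B))
  (_⇒_ : Op₂ (BooleanAlgebra.Carrier B))
  (isPreconditional : IsPreconditional (BooleanAlgebra.boundedLattice B) _⇒_)
  where

  open BooleanAlgebra B renaming (¬_ to ∼_)
  open AtomFrame B fin _⇒_ isPreconditional
  open FiniteSearch fin
  open Inverse (proj₂ fin) using (to; from; strictlyInverseˡ)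

  -- Complements and atoms.

  ∼-disjoint : ∀ {x y} → x ≤ y → x ≤ ∼ y → x ≈ ⊥
  ∼-disjoint {x} {y} x≤y x≤∼y =
    -- Residuation holds with `∼ y ∨ z` as the implication from `y` to `z`, so `∼ y ≤ ∼ y ∨ ⊥`
    -- transposes to `∼ y ∧ y ≤ ⊥`.
    antisym (trans (∧-greatest x≤∼y x≤y) (transpose-∧ (x≤x∨y (∼ y) ⊥))) (minimum x)

  disjoint-∼ : ∀ {x y} → x ∧ y ≈ ⊥ → x ≤ ∼ y
  disjoint-∼ {x} {y} e =
    trans (transpose-⇨ (reflexive e)) (∨-least refl (minimum (∼ y)))

  -- Both `y` and `z` lie below `∼ x ∨ z`, hence so does `y ∨ z`; residuation then gives
  -- `(y ∨ z) ∧ x ≤ z`.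
  ∨-resolve : ∀ {x y z} → x ∧ y ≤ ⊥ → x ≤ y ∨ z → x ≤ z
  ∨-resolve {x} {y} {z} x∧y≤⊥ x≤y∨z = trans (∧-greatest x≤y∨z refl)
    (transpose-∧ (∨-least
      (transpose-⇨ (trans (∧-greatest (x∧y≤y y x) (x∧y≤x y x)) (trans x∧y≤⊥ (minimum z))))
      (y≤x∨y (∼ x) z)))

  ∧∼≈⊥⇒≤ : ∀ {x y} → x ∧ ∼ y ≈ ⊥ → x ≤ y
  ∧∼≈⊥⇒≤ {x} {y} e = ∨-resolve (reflexive e)
    -- Excluded middle: `x ∧ y ≤ y` transposes to `x ≤ ∼ y ∨ y`.
    (transpose-⇨ (x∧y≤y x y))

  atom-∧ : ∀ {x} → IsAtom x → ∀ y → x ∧ y ≈ ⊥ ⊎ x ≤ y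
  atom-∧ {x} (_ , min) y with min (x ∧ y) (x∧y≤x x y)
  ... | inj₁ e = inj₁ e
  ... | inj₂ e = inj₂ (trans (reflexive (Eq.sym e)) (x∧y≤y x y))

  atom-∼ : ∀ {x} → IsAtom x → ∀ y → x ≤ y ⊎ x ≤ ∼ y
  atom-∼ at y with atom-∧ at y
  ... | inj₁ e = inj₂ (disjoint-∼ e)
  ... | inj₂ x≤y = inj₁ x≤y

  atom-∨ : ∀ {x} → IsAtom x → ∀ {y z} → x ≤ y ∨ z → x ≤ y ⊎ x ≤ z
  atom-∨ at {y} x≤y∨z with atom-∧ at y
  ... | inj₁ e = inj₂ (∨-resolve (reflexive e) x≤y∨z)
  ... | inj₂ x≤y = inj₁ x≤y

  atom≤atom : ∀ {x y} → IsAtom x → IsAtom y → x ≤ y → x ≈ y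
  atom≤atom {x} (x≉⊥ , _) (_ , min) x≤y = [ (λ e → contradiction e x≉⊥) , id ]′ (min x x≤y)

  -- Both x ≉ ⊥ and membership in an ultrafilter are splitting; meeting an element
  -- with each y or ∼ y of an enumeration of B in turn, keeping P, ends at an atom.
  Splitting : Pred Carrier p → Set (c ⊔ p)
  Splitting P = ∀ x y → P x → P (x ∧ y) ⊎ P (x ∧ ∼ y)

  refine : {P : Pred Carrier p} → Splitting P → ∀ {x} → P x → ∀ {k} (f : Fin k → Carrier) →
           ∃[ z ] P z × z ≤ x × ∀ i → z ≤ f i ⊎ z ≤ ∼ f i
  refine split {x} px {zero} f = x , px , refl , λ ()
  refine split {x} px {suc k} f with split x (f zero) px
  ... | inj₁ q = let z , pz , z≤ , d = refine split q (f ∘ suc) in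
    z , pz , trans z≤ (x∧y≤x _ _) ,
    λ { zero → inj₁ (trans z≤ (x∧y≤y _ _)) ; (suc i) → d i }
  ... | inj₂ q = let z , pz , z≤ , d = refine split q (f ∘ suc) in
    z , pz , trans z≤ (x∧y≤x _ _) ,
    λ { zero → inj₂ (trans z≤ (x∧y≤y _ _)) ; (suc i) → d i }

  splitting⇒atom : {P : Pred Carrier p} → Splitting P → (∀ {x} → P x → ¬ (x ≈ ⊥)) →
                   ∀ {x} → P x → ∃[ z ] IsAtom z × P z × z ≤ x
  splitting⇒atom split proper px with refine split px to
  ... | z , pz , z≤x , decides = z , (proper pz , min) , pz , z≤x
    where
    min : ∀ y → y ≤ z → y ≈ ⊥ ⊎ y ≈ z
    -- The enumeration reaches `y`, so `z ≤ y` or `z ≤ ∼ y`; in the second case `y ≤ z ≤ ∼ y` forces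
    -- `y ≈ ⊥`.
    min y y≤z with decides (from y)
    ... | inj₁ z≤ = inj₂ (antisym y≤z (trans z≤ (reflexive (strictlyInverseˡ y))))
    ... | inj₂ z≤ = inj₁ (∼-disjoint (reflexive (Eq.sym (strictlyInverseˡ y))) (trans y≤z z≤))

  atom-below : ∀ {x} → ¬ (x ≈ ⊥) → ∃[ z ] IsAtom z × z ≤ x
  atom-below x≉⊥ with splitting⇒atom split id x≉⊥
    where
    split : Splitting (λ x → ¬ (x ≈ ⊥))
    split x y x≉⊥ with x ∧ y ≟ ⊥
    ... | no ≉⊥ = inj₁ ≉⊥
    ... | yes e = inj₂ λ e′ → x≉⊥ (∼-disjoint (∧∼≈⊥⇒≤ e′) (disjoint-∼ e))
  ... | z , at , _ , z≤x = z , at , z≤x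

  -- The isomorphism `hat` onto the powerset of the atoms.

  hat⁺ : ∀ {a} w → proj₁ w ≤ a → w ∈ hat a
  hat⁺ {a} w = Equivalence.from (∈hat a w)

  hat⁻ : ∀ {a} w → w ∈ hat a → proj₁ w ≤ a
  hat⁻ {a} w = Equivalence.to (∈hat a w)

  -- If `a ∧ ∼ b` is not `⊥`, an atom below it is in `hat a` but not in `hat b`.
  hat-cancel : ∀ {a b} → hat a ⊆ hat b → a ≤ b
  hat-cancel {a} {b} sub with a ∧ ∼ b ≟ ⊥
  ... | yes e = ∧∼≈⊥⇒≤ e
  ... | no ≉⊥ = let z , at , z≤ = atom-below ≉⊥
                    w = z , at
                in contradiction
                     (∼-disjoint (hat⁻ {b} w (sub w (hat⁺ {a} w (trans z≤ (x∧y≤x _ _)))))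
                                 (trans z≤ (x∧y≤y _ _)))
                     (proj₁ at)

  hat-injective : ∀ {a b} → hat a ≐ hat b → a ≈ b
  hat-injective (f , g) = antisym (hat-cancel f) (hat-cancel g)

  -- The witness is the join of those listed elements that are atoms in `A`; with all of `B` listed
  -- it is the preimage of `A` under `hat`.
  partial-join : ∀ A {k} (f : Fin k → Carrier) →
                 ∃[ a ] hat a ⊆ A × (∀ i (at : IsAtom (f i)) → (f i , at) ∈ A → f i ≤ a)
  partial-join A {zero} f =
    ⊥ , (λ w w∈ → contradiction (antisym (hat⁻ {⊥} w w∈) (minimum _)) (proj₁ (proj₂ w))) , λ ()
  partial-join A {suc k} f with partial-join A (f ∘ suc) | isAtom? (f zero)
  ... | a , sub , above | no ¬at = a , sub ,
    λ { zero at _ → contradiction at ¬at ; (suc i) → above i }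
  ... | a , sub , above | yes at with (f zero , at) ∈? A
  ... | no ∉A = a , sub ,
    λ { zero at′ ∈A → contradiction (∈-resp A {f zero , at′} {f zero , at} Eq.refl ∈A) ∉A
      ; (suc i) → above i }
  ... | yes ∈A = f zero ∨ a ,
    -- Atoms are join-prime, and an atom below the atom `f zero` equals it.
    (λ w w∈ → [ (λ le → ∈-resp A {f zero , at} {w} (Eq.sym (atom≤atom (proj₂ w) at le)) ∈A)
              , (λ le → sub w (hat⁺ {a} w le)) ]′
              (atom-∨ (proj₂ w) (hat⁻ {f zero ∨ a} w w∈))) ,
    λ { zero _ _ → x≤x∨y _ _ ; (suc i) at′ ∈A′ → trans (above i at′ ∈A′) (y≤x∨y _ _) }

  hat-surjective : ∀ A → ∃[ a ] hat a ≐ A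
  hat-surjective A with partial-join A to
  ... | a , sub , above = a , sub , λ (x , at) x∈A →
    let e   = strictlyInverseˡ x
        at′ = isAtom-resp (Eq.sym e) at
    in hat⁺ {a} (x , at) (trans (reflexive (Eq.sym e))
         (above (from x) at′ (∈-resp A {x , at} {to (from x) , at′} (Eq.sym e) x∈A)))

  hat-isOrderIsomorphism : IsOrderIsomorphism _≈_ _≐_ _≤_ _⊆_ hat
  hat-isOrderIsomorphism = record
    { isOrderMonomorphism = record
      { isOrderHomomorphism = record { cong = hat-cong ; mono = hat-mono }
      ; injective = hat-injective
      ; cancel = hat-cancel }
    ; surjective = λ A → let a , sub , sup = hat-surjective A in
        a , λ e → (λ w → sub w ∘ proj₁ (hat-cong e) w) , (λ w → proj₂ (hat-cong e) w ∘ sup w) }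

  hat-∧ : ∀ a b → hat (a ∧ b) ≐ hat a ∩ hat b
  hat-∧ a b =
    (λ w w∈ → let le = hat⁻ {a ∧ b} w w∈ in
      Equivalence.from T-∧ (hat⁺ {a} w (trans le (x∧y≤x a b)) , hat⁺ {b} w (trans le (x∧y≤y a b)))) ,
    (λ w w∈ → let p , q = Equivalence.to T-∧ w∈ in
      hat⁺ {a ∧ b} w (∧-greatest (hat⁻ {a} w p) (hat⁻ {b} w q)))

  hat-∨ : ∀ a b → hat (a ∨ b) ≐ hat a ∪ hat b
  hat-∨ a b =
    (λ w w∈ → Equivalence.from T-∨
      ([ inj₁ ∘ hat⁺ {a} w , inj₂ ∘ hat⁺ {b} w ]′ (atom-∨ (proj₂ w) (hat⁻ {a ∨ b} w w∈)))) ,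
    (λ w w∈ → hat⁺ {a ∨ b} w
      ([ (λ p → trans (hat⁻ {a} w p) (x≤x∨y a b)) , (λ q → trans (hat⁻ {b} w q) (y≤x∨y a b)) ]′
       (Equivalence.to T-∨ w∈)))

  hat-∼ : ∀ a → hat (∼ a) ≐ ∁ (hat a)
  hat-∼ a =
    (λ w w∈ → T-not⁺ λ w∈′ →
      contradiction (∼-disjoint (hat⁻ {a} w w∈′) (hat⁻ {∼ a} w w∈)) (proj₁ (proj₂ w))) ,
    (λ w w∉ → [ (λ le → contradiction (hat⁺ {a} w le) (T-not⁻ w∉)) , hat⁺ {∼ a} w ]′
                (atom-∼ (proj₂ w) a))

  hat-⊤ : hat ⊤ ≐ full
  hat-⊤ = (λ _ _ → tt) , (λ w _ → hat⁺ {⊤} w (maximum _))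

  hat-⊥ : hat ⊥ ≐ ∅
  hat-⊥ = (λ w w∈ → contradiction (antisym (hat⁻ {⊥} w w∈) (minimum _)) (proj₁ (proj₂ w))) ,
          (λ _ ())

  hat-isBooleanIsomorphism : IsBooleanIsomorphism B ℘ hat
  hat-isBooleanIsomorphism = record
    { isOrderIsomorphism = hat-isOrderIsomorphism
    ; ∧-homo = hat-∧ ; ∨-homo = hat-∨ ; ¬-homo = hat-∼ ; ⊤-homo = hat-⊤ ; ⊥-homo = hat-⊥ }

  -- Passing between `R` and `Rhat`.

  R-hat : ∀ {a w v} → R (hat a) w v → Rhat a w v
  R-hat {w = w} {v} (a′ , e , r) = Rhat-resp {w = w} {w} {v} {v} (hat-injective e) Eq.refl Eq.refl r

  Rhat-hat : ∀ {a w v} → Rhat a w v → R (hat a) w v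
  Rhat-hat {a} r = a , ((λ _ → id) , (λ _ → id)) , r

  R-resp : ∀ {A C w x v u} → A ≐ C → proj₁ w ≈ proj₁ x → proj₁ v ≈ proj₁ u → R A w v → R C x u
  R-resp {w = w} {x} {v} {u} (A⊆C , C⊆A) w≈x v≈u (a , (f , g) , r) =
    a , ((λ y → A⊆C y ∘ f y) , (λ y → g y ∘ C⊆A y)) , Rhat-resp {w = w} {x} {v} {u} Eq.refl w≈x v≈u r

  -- The filter of all `b` with `w ≤ a ⇒ b`.

  module NegationImporting
    (modusPonens : ModusPonens boundedLattice _⇒_)
    (identity : Identity boundedLattice _⇒_)
    (normality : Normality boundedLattice _⇒_)
    (negationImport : NegationImport B _⇒_)
    where

    open IsPreconditional isPreconditional

    -- As `b ≤ b′` makes `b` equal to `b′ ∧ b`, `axiom₄` applies.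
    ⇒-mono : ∀ {a b b′} → b ≤ b′ → a ⇒ b ≤ a ⇒ b′
    ⇒-mono {a} {b} {b′} b≤b′ =
      trans (reflexive (⇒-cong Eq.refl (antisym (∧-greatest b≤b′ refl) (x∧y≤y b′ b))))
            (axiom₄ a b′ b)

    ≤⇒self : ∀ x a → x ≤ a ⇒ a
    ≤⇒self x a = trans (maximum x) (reflexive (Eq.sym (identity a)))

    ultra : ∀ {w} → IsAtom w → ∀ a b → w ≤ a ⇒ b ⊎ w ≤ a ⇒ (∼ b)
    ultra at a b with atom-∼ at (a ⇒ b)
    ... | inj₁ le = inj₁ le
    ... | inj₂ le = inj₂ (trans le (negationImport a b))

    -- By `ultra` and normality, membership in the filter is splitting; identity supplies `a` as the
    -- element to start from.
    generator : ∀ {w} → IsAtom w → ∀ a → ¬ (w ≤ a ⇒ ⊥) → ∃[ u ] IsAtom u × w ≤ a ⇒ u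
    generator {w} at a proper =
      let u , atu , w≤ , _ = splitting⇒atom split
            (λ w≤ e → proper (trans w≤ (⇒-mono (reflexive e)))) (≤⇒self w a)
      in u , atu , w≤
      where
      split : Splitting (λ b → w ≤ a ⇒ b)
      split x y w≤ with ultra at a y
      ... | inj₁ w≤y = inj₁ (trans (∧-greatest w≤ w≤y) (normality a x y))
      ... | inj₂ w≤y = inj₂ (trans (∧-greatest w≤ w≤y) (normality a x (∼ y)))

    -- Successors under `Rhat`.

    generator-Rhat : ∀ {a} (w u : Atom) → ¬ (proj₁ w ≤ a ⇒ ⊥) → proj₁ w ≤ a ⇒ proj₁ u → Rhat a w u
    generator-Rhat {a} w (u , atu) proper w≤u b w≤b with atom-∧ atu b
    ... | inj₂ u≤b = u≤b
    -- If the filter contained both `u` and a disjoint `b`, normality would put `⊥` in it.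
    ... | inj₁ e = contradiction
      (trans (∧-greatest w≤u w≤b) (trans (normality a u b) (⇒-mono (reflexive e)))) proper

    Rhat-generates : ∀ {a} (w v : Atom) → Rhat a w v → proj₁ w ≤ a ⇒ proj₁ v
    Rhat-generates {a} (w , atw) (v , atv) r with ultra atw a v
    ... | inj₁ w≤ = w≤
    -- With `∼ v` in the filter, the successor `v` would lie below `∼ v`.
    ... | inj₂ w≤ = contradiction (∼-disjoint refl (r (∼ v) w≤)) (proj₁ atv)

    -- The filter contains `v`, so its successor `u` lies below `v`, and both are atoms.
    Rhat-functional : ∀ {a} (w v u : Atom) → Rhat a w v → Rhat a w u → proj₁ v ≈ proj₁ u
    Rhat-functional w v u r s =
      Eq.sym (atom≤atom (proj₂ u) (proj₂ v) (s (proj₁ v) (Rhat-generates w v r)))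

    Rhat-centered : ∀ {a} (w v : Atom) → proj₁ w ≤ a → Rhat a w v → proj₁ v ≈ proj₁ w
    Rhat-centered {a} (w , atw) (v , atv) w≤a r =
      atom≤atom atv atw (r w (trans (∧-greatest w≤a refl) (axiom₂ a w)))

    Rhat-reflexive : ∀ {a} (w v : Atom) → proj₁ w ≤ a → proj₁ v ≈ proj₁ w → Rhat a w v
    Rhat-reflexive {a} w v w≤a v≈w b w≤ =
      trans (reflexive v≈w) (trans (∧-greatest w≤a w≤) (modusPonens a b))

    Rhat-dense : ∀ {a b} (w v : Atom) → Rhat (a ∧ b) w v →
                 ∃[ u ] Rhat a w u × Rhat (a ∧ b) u v
    Rhat-dense {a} {b} (w , atw) (v , atv) r =
      (u , atu) , generator-Rhat (w , atw) (u , atu) proper w≤u ,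
      -- From `u ≤ (a ∧ b) ⇒ d` follows `w ≤ a ⇒ u ≤ a ⇒ ((a ∧ b) ⇒ d)`, which `axiom₅` collapses.
      λ d u≤ → r d (absorb (trans w≤u (⇒-mono u≤)))
      where
      absorb : ∀ {d} → w ≤ a ⇒ ((a ∧ b) ⇒ d) → w ≤ (a ∧ b) ⇒ d
      absorb le = trans le (axiom₅ a b _)

      proper : ¬ (w ≤ a ⇒ ⊥)
      -- If `⊥` were in the filter of `a`, so would be `(a ∧ b) ⇒ ⊥`; then `w ≤ (a ∧ b) ⇒ ⊥`, and
      -- `r` would give `v ≤ ⊥`.
      proper le = proj₁ atv (antisym (r ⊥ (absorb (trans le (⇒-mono (minimum _))))) (minimum v))

      gen : ∃[ u ] IsAtom u × w ≤ a ⇒ u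
      gen = generator atw a proper

      u = proj₁ gen
      atu = proj₁ (proj₂ gen)
      w≤u = proj₂ (proj₂ gen)

    Rhat-complete : ∀ {a b} (w : Atom) → (∀ v → Rhat a w v → proj₁ v ≤ b) → proj₁ w ≤ a ⇒ b
    Rhat-complete {a} {b} (w , atw) h with w ≤? a ⇒ ⊥
    -- An improper filter contains every `b`.
    ... | yes w≤ = trans w≤ (⇒-mono (minimum b))
    ... | no proper =
      let u , atu , w≤u = generator atw a proper
      -- The generator is itself a successor, so `h` puts it below `b`.
      in trans w≤u (⇒-mono (h (u , atu) (generator-Rhat (w , atw) (u , atu) proper w≤u)))

    -- The frame conditions for `R`.

    isSelectionFrame : ¬ (⊤ ≈ ⊥) → IsSelectionFrame W R
    isSelectionFrame ⊤≉⊥ = record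
      { nonempty  = let z , at , _ = atom-below ⊤≉⊥ in z , at
      ; R-resp    = λ {A} {C} {w} {x} {v} {u} → R-resp {A} {C} {w} {x} {v} {u}
      -- By identity the filter contains `a`, hence `v ≤ a`.
      ; success   = λ { w v A (a , (sub , _) , r) → sub v (hat⁺ {a} v (r a (≤⇒self _ a))) }
      ; centering = λ w v A w∈A → mk⇔
          (λ { (a , (_ , sup) , r) → Rhat-centered w v (hat⁻ {a} w (sup w w∈A)) r })
          (λ v≈w → let a , sub , sup = hat-surjective A in
            a , (sub , sup) , Rhat-reflexive w v (hat⁻ {a} w (sup w w∈A)) v≈w) }

    functional : Functional W R
    functional w v u A (a , (f , g) , r) (a′ , (f′ , g′) , s) =
      Rhat-functional w v u r (Rhat-resp {w = w} {w} {u} {u}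
        (hat-injective ((λ x → g x ∘ f′ x) , (λ x → g′ x ∘ f x))) Eq.refl Eq.refl s)

    stronglyDense : StronglyDense W R
    stronglyDense w v A C (d , (f , g) , r) =
      let a , a⊆ , a⊇ = hat-surjective A
          b , b⊆ , b⊇ = hat-surjective C
          ∧⊆ , ∧⊇ = hat-∧ a b
          ab⊆ : hat (a ∧ b) ⊆ A ∩ C
          ab⊆ x x∈ = let p , q = Equivalence.to T-∧ (∧⊆ x x∈) in
                     Equivalence.from T-∧ (a⊆ x p , b⊆ x q)
          ab⊇ : A ∩ C ⊆ hat (a ∧ b)
          ab⊇ x x∈ = let p , q = Equivalence.to T-∧ x∈ in
                     ∧⊇ x (Equivalence.from T-∧ (a⊇ x p , b⊇ x q))
          -- Both `d` and `a ∧ b` represent `A ∩ C`, so they are equal and `Rhat-dense` applies.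
          d≈ = hat-injective ((λ x → ab⊇ x ∘ f x) , (λ x → g x ∘ ab⊆ x))
          u , wu , uv = Rhat-dense w v (Rhat-resp {w = w} {w} {v} {v} d≈ Eq.refl Eq.refl r)
      in u , (a , (a⊆ , a⊇) , wu) , (a ∧ b , (ab⊆ , ab⊇) , uv)

    -- Preservation of the conditional.

    hat-⇒ : ∀ a b → hat (a ⇒ b) ≐ (hat a →R hat b)
    hat-⇒ a b =
      (λ w w∈ → Equivalence.from (∈→R w) λ v r →
        hat⁺ {b} v (R-hat {a} {w} {v} r b (hat⁻ {a ⇒ b} w w∈))) ,
      (λ w w∈ → hat⁺ {a ⇒ b} w (Rhat-complete w λ v r →
        hat⁻ {b} v (Equivalence.to (∈→R w) w∈ v (Rhat-hat {a} {w} {v} r))))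
      where
      ∈→R : ∀ w → w ∈ (hat a →R hat b) ⇔ Conditional W R (hat a) (hat b) w
      ∈→R = ∈⟪⟫ (R-conditional? (hat a) (hat b))
                  (λ {w} {w′} → R-conditional-resp (hat a) (hat b) {w} {w′})

proposition7 : ∀ {c ℓ₁ ℓ₂ : Level} (B : BooleanAlgebra c ℓ₁ ℓ₂) →
    let module B = BooleanAlgebra B in
    (fin : Finite B.setoid) →
    ¬ (B.⊤ B.≈ B.⊥) →
    (_⇒_ : Op₂ B.Carrier) →
    (isPreconditional : IsPreconditional B.boundedLattice _⇒_) →
    ModusPonens B.boundedLattice _⇒_ →
    Identity B.boundedLattice _⇒_ →
    Normality B.boundedLattice _⇒_ →
    NegationImport B _⇒_ →
    let module F = AtomFrame B fin _⇒_ isPreconditional in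
    IsBooleanIsomorphism B F.℘ F.hat ×
    IsSelectionFrame F.W F.R ×
    StronglyDense F.W F.R ×
    Functional F.W F.R ×
    Isomorphic B _⇒_ F.℘ F._→R_
proposition7 B fin ⊤≉⊥ _⇒_ isPreconditional modusPonens identity normality negationImport =
  hat-isBooleanIsomorphism , isSelectionFrame ⊤≉⊥ , stronglyDense , functional ,
  hat , hat-isBooleanIsomorphism , hat-⇒
  where
  open AtomFrame B fin _⇒_ isPreconditional using (hat)
  open FiniteBooleanAlgebra B fin _⇒_ isPreconditional
  open NegationImporting modusPonens identity normality negationImport
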